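{- Let $(X,*,0)$ be a solid branchwise implicative weak BCC-algebra. Then $X$ is branchwise positive implicative if and only if $X$ is a commutative BCK-algebra.
   Context: A weak BCC-algebra is a set $X$ with a binary operation $*$ and a constant $0$ satisfying, for all $x,y,z\in X$: (i) $((x*y)*(z*y))*(x*z)=0$; (ii) $x*x=0$; (iii) $x*0=x$; (iv) $x*y=y*x=0$ implies $x=y$. The relation $x\leqslant y$ iff $x*y=0$ is a partial order on $X$. Let $I(X)$ be the set of minimal elements of $X$ with respect to $\leqslant$. For $a\in I(X)$ the branch initiated by $a$ is $B(a)=\{x\in X: a\leqslant x\}$; "belonging to the same branch" means lying in a common $B(a)$. A weak BCC-algebra is called (left) solid if $(x*y)*z=(x*z)*y$ holds for all $x,y$ belonging to the same branch and all $z\in X$. It is branchwise implicative if $x*(y*x)=x$ for all $x,y$ in the same branch, and branchwise positive implicative if $(x*y)*y=x*y$ for all $x,y$ in the same branch. A BCK-algebra is a weak BCC-algebra satisfying $0*x=0$ and $(x*y)*z=(x*z)*y$ for all $x,y,z$; it is commutative if $x*(x*y)=y*(y*x)$ for all $x,y$. -}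

module Defs where

open import Algebra.Core using (Op₂)
import Algebra.Definitions as AlgebraDefinitions
open import Algebra.Structures using (IsMagma)
open import Data.Product using (_×_; ∃-syntax)
open import Level using (Level; _⊔_; suc)
open import Relation.Binary.Core using (Rel)
open import Relation.Unary using (Pred; _∈_)

-- As for the algebraic structures of the standard library, the underlying
-- set is a setoid: equality is an arbitrary equivalence relation _≈_
-- respected by _*_. Taking _≈_ to be _≡_ recovers algebras on a plain set.

module _ {c ℓ : Level} {A : Set c} (_≈_ : Rel A ℓ) (_*_ : Op₂ A) (0# : A) where

  open AlgebraDefinitions _≈_ using (RightIdentity; LeftZero)

  record IsWeakBCCAlgebra : Set (c ⊔ ℓ) where
    field
      isMagma     : IsMagma _≈_ _*_
      bcc         : ∀ x y z → (((x * y) * (z * y)) * (x * z)) ≈ 0#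
      *-self      : ∀ x → (x * x) ≈ 0#
      *-identityʳ : RightIdentity 0# _*_
      *-antisym   : ∀ x y → (x * y) ≈ 0# → (y * x) ≈ 0# → x ≈ y

    open IsMagma isMagma public renaming (∙-cong to *-cong)

  record IsBCKAlgebra : Set (c ⊔ ℓ) where
    field
      isWeakBCCAlgebra : IsWeakBCCAlgebra
      *-zeroˡ          : LeftZero 0# _*_
      *-exchange       : ∀ x y z → ((x * y) * z) ≈ ((x * z) * y)

    open IsWeakBCCAlgebra isWeakBCCAlgebra public

  -- Commutativity here is not commutativity of _*_, but of the derived
  -- operation sending x and y to y * (y * x).
  record IsCommutativeBCKAlgebra : Set (c ⊔ ℓ) where
    field
      isBCKAlgebra  : IsBCKAlgebra
      commutative   : ∀ x y → (x * (x * y)) ≈ (y * (y * x))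

    open IsBCKAlgebra isBCKAlgebra public

record WeakBCCAlgebra c ℓ : Set (suc (c ⊔ ℓ)) where
  infixl 7 _*_
  infix  4 _≈_ _≤_
  field
    Carrier          : Set c
    _≈_              : Rel Carrier ℓ
    _*_              : Op₂ Carrier
    0#               : Carrier
    isWeakBCCAlgebra : IsWeakBCCAlgebra _≈_ _*_ 0#

  open IsWeakBCCAlgebra isWeakBCCAlgebra public

  _≤_ : Rel Carrier ℓ
  x ≤ y = x * y ≈ 0#

  I : Pred Carrier (c ⊔ ℓ)
  I a = ∀ x → x ≤ a → x ≈ a

  B : Carrier → Pred Carrier ℓ
  B a x = a ≤ x

  SameBranch : Rel Carrier (c ⊔ ℓ)
  SameBranch x y = ∃[ a ] (a ∈ I × x ∈ B a × y ∈ B a)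

  Solid : Set (c ⊔ ℓ)
  Solid = ∀ x y z → SameBranch x y → (x * y) * z ≈ (x * z) * y

  BranchwiseImplicative : Set (c ⊔ ℓ)
  BranchwiseImplicative = ∀ x y → SameBranch x y → x * (y * x) ≈ x

  BranchwisePositiveImplicative : Set (c ⊔ ℓ)
  BranchwisePositiveImplicative = ∀ x y → SameBranch x y → (x * y) * y ≈ x * y

{-# OPTIONS --safe #-}
module Submission where

open import Data.Product using (_,_)
open import Defs
open import Function.Bundles using (_⇔_; mk⇔)
import Relation.Binary.Reasoning.Setoid as SetoidReasoning

-- In a solid weak BCC-algebra every element 0 * u is minimal, so every x lies
-- in the branch of 0 * (0 * x). Positive implicativity applied to the pair
-- x, x then reads 0 * x = 0: there is only one branch, solidity becomes the
-- exchange law, and implicative BCK-algebras are commutative. Conversely, when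
-- there is a single branch, y = y * (x * y) and implicativity for the pair
-- x * y, y give (x * y) * y = (x * y) * (y * (x * y)) = x * y.

module WeakBCCProperties {c ℓ} (X : WeakBCCAlgebra c ℓ) where
  open WeakBCCAlgebra X

  open SetoidReasoning setoid

  ≤0⇒≈0 : ∀ {x} → x ≤ 0# → x ≈ 0#
  ≤0⇒≈0 {x} x≤0 = trans (sym (*-identityʳ x)) x≤0

  ≤-respˡ-≈ : ∀ {x y z} → x ≈ y → x ≤ z → y ≤ z
  ≤-respˡ-≈ x≈y x≤z = trans (*-cong (sym x≈y) refl) x≤z

  ≤-respʳ-≈ : ∀ {x y z} → y ≈ z → x ≤ y → x ≤ z
  ≤-respʳ-≈ y≈z x≤y = trans (*-cong refl (sym y≈z)) x≤y

  *-monoˡ-≤ : ∀ {x y} z → x ≤ y → x * z ≤ y * z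
  *-monoˡ-≤ {x} {y} z x≤y = ≤0⇒≈0 (≤-respʳ-≈ x≤y (bcc x z y))

  -- Since `x * y` vanishes, `bcc z y x` collapses to `(z * y) * (z * x) ≈ 0#`.
  *-antiʳ-≤ : ∀ {x y} z → x ≤ y → z * y ≤ z * x
  *-antiʳ-≤ {x} {y} z x≤y = ≤-respˡ-≈ zy*xy≈zy (bcc z y x)
    where
    zy*xy≈zy : (z * y) * (x * y) ≈ z * y
    zy*xy≈zy = trans (*-cong refl x≤y) (*-identityʳ (z * y))

  ≤-trans : ∀ {x y z} → x ≤ y → y ≤ z → x ≤ z
  ≤-trans {z = z} x≤y y≤z = ≤0⇒≈0 (≤-respʳ-≈ y≤z (*-monoˡ-≤ z x≤y))

  0*[x*y]≤y*x : ∀ x y → 0# * (x * y) ≤ y * x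
  0*[x*y]≤y*x x y = ≤-respˡ-≈ (*-cong (*-self y) refl) (bcc y y x)

  0*[0*x]≤x : ∀ x → 0# * (0# * x) ≤ x
  0*[0*x]≤x x = ≤-respʳ-≈ (*-identityʳ x) (0*[x*y]≤y*x 0# x)

  x≤y⇒0≤y*x : ∀ {x y} → x ≤ y → 0# ≤ y * x
  x≤y⇒0≤y*x {x} {y} x≤y = ≤0⇒≈0 (≤-respʳ-≈ x≤y (0*[x*y]≤y*x y x))

  0∈I : I 0#
  0∈I _ = ≤0⇒≈0

  module _ (solid : Solid) where

    -- From `0# ≤ y * x`, the elements `0#` and `y * x` share the branch of `0#`, so solidity
    -- absorbs the factor `y * x` in `bcc 0# x y`. As `*-antiʳ-≤` gives the reverse inequality,
    -- `0# * x` and `0# * y` even coincide.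
    0*-mono-≤ : ∀ {x y} → x ≤ y → 0# * x ≤ 0# * y
    0*-mono-≤ {x} {y} x≤y = ≤-respˡ-≈ 0x*yx≈0x (bcc 0# x y)
      where
      0≤yx : 0# ≤ y * x
      0≤yx = x≤y⇒0≤y*x x≤y

      0x*yx≈0x : (0# * x) * (y * x) ≈ 0# * x
      0x*yx≈0x = begin
        (0# * x) * (y * x) ≈⟨ solid 0# (y * x) x (0# , 0∈I , *-self 0# , 0≤yx) ⟨
        (0# * (y * x)) * x ≈⟨ *-cong 0≤yx refl ⟩
        0# * x             ∎

    0*-minimal : ∀ u → I (0# * u)
    0*-minimal u x x≤0u = *-antisym x (0# * u) x≤0u 0u≤x
      where
      0u≤x : 0# * u ≤ x
      -- The chain is `0# * u ≤ 0# * (0# * (0# * u)) ≤ 0# * (0# * x) ≤ x`.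
      0u≤x = ≤-trans (*-antiʳ-≤ 0# (0*[0*x]≤x u))
               (≤-trans (0*-mono-≤ (*-antiʳ-≤ 0# x≤0u)) (0*[0*x]≤x x))

    sameBranch-refl : ∀ x → SameBranch x x
    sameBranch-refl x =
      0# * (0# * x) , 0*-minimal (0# * x) , 0*[0*x]≤x x , 0*[0*x]≤x x

    positiveImplicative⇒0≤ : BranchwisePositiveImplicative → ∀ x → 0# ≤ x
    positiveImplicative⇒0≤ positive x = begin
      0# * x      ≈⟨ *-cong (*-self x) refl ⟨
      (x * x) * x ≈⟨ positive x x (sameBranch-refl x) ⟩
      x * x       ≈⟨ *-self x ⟩
      0#          ∎

  -- The meeting point of both directions: positive implicativity yields this hypothesis in one, the
  -- BCK law `*-zeroˡ` in the other.
  module _ (0≤_ : ∀ x → 0# ≤ x) where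

    sameBranch-total : ∀ x y → SameBranch x y
    sameBranch-total x y = 0# , 0∈I , 0≤ x , 0≤ y

    x*y≤x : ∀ x y → x * y ≤ x
    x*y≤x x y = ≤-respʳ-≈ (*-identityʳ x) (*-antiʳ-≤ x (0≤ y))

    implicative⇒positiveImplicative :
      BranchwiseImplicative → BranchwisePositiveImplicative
    implicative⇒positiveImplicative implicative x y _ = begin
      (x * y) * y             ≈⟨ *-cong refl (implicative y x (sameBranch-total y x)) ⟨
      (x * y) * (y * (x * y)) ≈⟨ implicative (x * y) y (sameBranch-total (x * y) y) ⟩
      x * y                   ∎

    module _ (solid : Solid) (implicative : BranchwiseImplicative) where

      x*[x*y]≤y : ∀ x y → x * (x * y) ≤ y
      x*[x*y]≤y x y =
        trans (solid x (x * y) y (sameBranch-total x (x * y))) (*-self (x * y))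

      -- Right multiplication by `y * x` preserves the order and, by implicativity, fixes `x`.
      x≤y⇒x≤y*[y*x] : ∀ {x y} → x ≤ y → x ≤ y * (y * x)
      x≤y⇒x≤y*[y*x] {x} {y} x≤y =
        ≤-respˡ-≈ (implicative x y (sameBranch-total x y)) (*-monoˡ-≤ (y * x) x≤y)

      x*[x*y]≤y*[y*x] : ∀ x y → x * (x * y) ≤ y * (y * x)
      x*[x*y]≤y*[y*x] x y =
        -- Put `w = x * (x * y)`. From `w ≤ y` comes `w ≤ y * (y * w)`; from `w ≤ x`, two order
        -- reversals raise the inner `w` to `x`.
        ≤-trans (x≤y⇒x≤y*[y*x] (x*[x*y]≤y x y))
          (*-antiʳ-≤ y (*-antiʳ-≤ y (x*y≤x x (x * y))))

      isCommutativeBCKAlgebra : IsCommutativeBCKAlgebra _≈_ _*_ 0#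
      isCommutativeBCKAlgebra = record
        { isBCKAlgebra = record
          { isWeakBCCAlgebra = isWeakBCCAlgebra
          ; *-zeroˡ          = 0≤_
          ; *-exchange       = λ x y z → solid x y z (sameBranch-total x y)
          }
        ; commutative = λ x y → *-antisym (x * (x * y)) (y * (y * x))
            (x*[x*y]≤y*[y*x] x y) (x*[x*y]≤y*[y*x] y x)
        }

theorem3p9 : ∀ {c ℓ} (X : WeakBCCAlgebra c ℓ) → let open WeakBCCAlgebra X in
    Solid → BranchwiseImplicative →
    BranchwisePositiveImplicative ⇔ IsCommutativeBCKAlgebra _≈_ _*_ 0#
theorem3p9 X solid implicative = mk⇔
  (λ positive → isCommutativeBCKAlgebra
    (positiveImplicative⇒0≤ solid positive) solid implicative)
  (λ bck → implicative⇒positiveImplicative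
    (IsCommutativeBCKAlgebra.*-zeroˡ bck) implicative)
  where open WeakBCCProperties X
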